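{- For each finite graph $\mathcal{G}=(V,E)$ and each set $\mathsf{A}\subseteq V$, the game $\mathsf{GCDS}(\mathcal{G},\mathsf{A})$ is determined, i.e. one of the two players ONE and TWO has a winning strategy.
   Context: **The graph transformation gcds.** Let $\mathcal{G}=(V,E)$ be a graph and $\{x,y\}\in E$. The master list of $\{x,y\}$ has two columns: the first consists of all neighbors of $x$ in $\mathcal{G}$ except $y$, the second of all neighbors of $y$ in $\mathcal{G}$ except $x$. The graph $\mathbf{gcds}(\mathcal{G},\{x,y\})=(V,E')$ is defined as follows. Both $x$ and $y$ are isolated in it. For $p\ne q$ in $V\setminus\{x,y\}$: (a) if $p$ or $q$ is not in the master list, then $\{p,q\}\in E'$ iff $\{p,q\}\in E$; (b) if both are in the master list, then: (b.1) if no column contains both $p$ and $q$, then $\{p,q\}\in E'$ iff $\{p,q\}\notin E$; (b.2) if some column contains both and the total number of occurrences of $p$ and $q$ in the master list (both columns together) is even, then $\{p,q\}\in E'$ iff $\{p,q\}\in E$; (b.3) if some column contains both and that total number is odd, then $\{p,q\}\in E'$ iff $\{p,q\}\notin E$. **The modification $\mathbf{gcds}_2$.** For a finite graph $\mathcal{G}=(V,E)$ and $\{a,b\}\in E$, compute $(V,E')=\mathbf{gcds}(\mathcal{G},\{a,b\})$; then delete $a$ and $b$, and also delete every vertex $v$ in the master list of $\{a,b\}$ that is isolated in $(V,E')$, unless $v$ is the only vertex in the master list. With $V'$ the set of remaining vertices, $\mathbf{gcds}_2(\mathcal{G},\{a,b\})=(V',E')$. **The game.** For a finite graph $\mathcal{G}=(V,E)$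 and $\mathsf{A}\subseteq V$, the game $\mathsf{GCDS}(\mathcal{G},\mathsf{A})$ starts with current graph $\mathcal{G}$. Players ONE and TWO alternate, ONE moving first; a move consists of choosing an edge $\{a,b\}$ of the current graph $\mathcal{C}$ and replacing $\mathcal{C}$ by $\mathbf{gcds}_2(\mathcal{C},\{a,b\})$. The game ends when the current graph has no edges. If the vertex set of the final graph is nonempty and is a subset of $\mathsf{A}$, then ONE wins; otherwise TWO wins. -}

module Defs where

open import Data.Bool.Base using (Bool; true; false; T; not; _∧_; _∨_; if_then_else_)
open import Data.Bool.Properties using (∧-comm; ∨-comm; T-∧; T-∨; T?)
open import Data.Empty using (⊥-elim)
open import Data.Fin.Base using (Fin; _<_)
open import Data.Fin.Properties using (_≟_; any?; all?)
open import Data.Fin.Subset using (Subset; _∈_; _⊆_; Nonempty)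
open import Data.Fin.Subset.Properties using (_∈?_)
open import Data.Nat.Base using (ℕ; _+_)
open import Data.Nat.Divisibility using (_∣?_)
open import Data.Nat.Properties using (+-comm)
open import Data.Product.Base using (Σ; _×_; _,_; proj₁; proj₂)
open import Data.Sum.Base using (_⊎_; inj₁; inj₂)
open import Data.Unit.Base using (⊤; tt)
open import Data.Vec.Base using (tabulate)
open import Data.Vec.Properties using (lookup⇒[]=; lookup∘tabulate)
open import Function.Bundles using (module Equivalence)
open import Relation.Binary.PropositionalEquality
  using (_≡_; refl; sym; trans; subst)
open import Relation.Nullary using (¬_; does; yes; no; _→-dec_)
open import Relation.Nullary.Decidable using (dec-true)

private
  variable
    n : ℕ

-- Finite simple graphs whose vertex set is a subset of Fin n, so that deleting
-- vertices stays within the type.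
record Graph (n : ℕ) : Set where
  field
    vertices   : Subset n
    adj        : Fin n → Fin n → Bool
    adj-sym    : ∀ p q → adj p q ≡ adj q p
    adj-irrefl : ∀ p → adj p p ≡ false
    adj-closed : ∀ {p q} → T (adj p q) → p ∈ vertices

open Graph public

-- An unordered pair {a , b} is represented once, by its increasing listing.
record Edge (G : Graph n) : Set where
  constructor edge
  field
    a b      : Fin n
    a<b      : a < b
    adjacent : T (adj G a b)

module MasterList (G : Graph n) (x y : Fin n) where

  column₁ column₂ : Fin n → Bool
  column₁ p = adj G x p ∧ not (does (p ≟ y))
  column₂ p = adj G y p ∧ not (does (p ≟ x))

  listed : Fin n → Bool
  listed p = column₁ p ∨ column₂ p

  shareColumn : Fin n → Fin n → Bool
  shareColumn p q = (column₁ p ∧ column₁ q) ∨ (column₂ p ∧ column₂ q)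

  occurrences : Fin n → ℕ
  occurrences p = count (column₁ p) + count (column₂ p)
    where
    count : Bool → ℕ
    count c = if c then 1 else 0

  evenTotal : Fin n → Fin n → Bool
  evenTotal p q = does (2 ∣? (occurrences p + occurrences q))

  onlyListed : Fin n → Bool
  onlyListed v = does (all? λ q → T? (listed q) →-dec (q ≟ v))

  isEnd : Fin n → Bool
  isEnd p = does (p ≟ x) ∨ does (p ≟ y)

  -- The edges of gcds(G,{x,y}) for distinct p, q outside {x , y}.
  newAdj : Fin n → Fin n → Bool
  newAdj p q =
    if not (listed p ∧ listed q) then adj G p q
    else if not (shareColumn p q) then not (adj G p q)
    else if evenTotal p q then adj G p q
    else not (adj G p q)

  gcdsAdj : Fin n → Fin n → Bool
  gcdsAdj p q =
    if (isEnd p ∨ isEnd q) ∨ does (p ≟ q) then false else newAdj p q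

  private
    ≟-comm : (p q : Fin n) → does (p ≟ q) ≡ does (q ≟ p)
    ≟-comm p q with p ≟ q | q ≟ p
    ... | yes _   | yes _   = refl
    ... | no _    | no _    = refl
    ... | yes p≡q | no q≢p  = ⊥-elim (q≢p (sym p≡q))
    ... | no p≢q  | yes q≡p = ⊥-elim (p≢q (sym q≡p))

    ≟-diag : (p : Fin n) → does (p ≟ p) ≡ true
    ≟-diag p with p ≟ p
    ... | yes _  = refl
    ... | no p≢p = ⊥-elim (p≢p refl)

  newAdj-sym : ∀ p q → newAdj p q ≡ newAdj q p
  newAdj-sym p q
    rewrite ∧-comm (listed p) (listed q)
          | adj-sym G p q
          | ∧-comm (column₁ p) (column₁ q)
          | ∧-comm (column₂ p) (column₂ q)
          | +-comm (occurrences p) (occurrences q) = refl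

  gcdsAdj-sym : ∀ p q → gcdsAdj p q ≡ gcdsAdj q p
  gcdsAdj-sym p q
    rewrite ∨-comm (isEnd p) (isEnd q) | ≟-comm p q | newAdj-sym p q = refl

  gcdsAdj-irrefl : ∀ p → gcdsAdj p p ≡ false
  gcdsAdj-irrefl p rewrite ≟-diag p with isEnd p
  ... | true  = refl
  ... | false = refl

  listed-closed : ∀ p → T (listed p) → p ∈ vertices G
  listed-closed p l with Equivalence.to (T-∨ {column₁ p}) l
  ... | inj₁ c = adj-closed G
        (subst T (adj-sym G x p) (proj₁ (Equivalence.to (T-∧ {adj G x p}) c)))
  ... | inj₂ c = adj-closed G
        (subst T (adj-sym G y p) (proj₁ (Equivalence.to (T-∧ {adj G y p}) c)))

  newAdj-closed : ∀ p q → T (newAdj p q) → p ∈ vertices G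
  newAdj-closed p q t with listed p in lp
  ... | false = adj-closed G t
  ... | true  = listed-closed p (subst T (sym lp) tt)

  gcdsAdj-closed : ∀ p q → T (gcdsAdj p q) → p ∈ vertices G
  gcdsAdj-closed p q t with (isEnd p ∨ isEnd q) ∨ does (p ≟ q)
  ... | false = newAdj-closed p q t

  gcdsAdj-end : ∀ p q → T (gcdsAdj p q) → isEnd p ≡ false
  gcdsAdj-end p q t with isEnd p
  ... | false = refl

gcds : (G : Graph n) → Edge G → Graph n
gcds G (edge x y _ _) = record
  { vertices   = vertices G
  ; adj        = gcdsAdj
  ; adj-sym    = gcdsAdj-sym
  ; adj-irrefl = gcdsAdj-irrefl
  ; adj-closed = λ {p} {q} → gcdsAdj-closed p q
  }
  where open MasterList G x y

isolated : Graph n → Fin n → Bool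
isolated G v = not (does (any? λ q → T? (adj G v q)))

module _ (G : Graph n) (e : Edge G) where
  open Edge e
  open MasterList G a b

  deleted : Fin n → Bool
  deleted v = isEnd v ∨ (listed v ∧ isolated (gcds G e) v ∧ not (onlyListed v))

  remaining : Subset n
  remaining = tabulate λ v → does (v ∈? vertices G) ∧ not (deleted v)

  private
    nonisolated : ∀ {p q} → T (gcdsAdj p q) → isolated (gcds G e) p ≡ false
    nonisolated {p} {q} t with any? (λ r → T? (adj (gcds G e) p r))
    ... | yes _   = refl
    ... | no none = ⊥-elim (none (q , t))

    kept : ∀ {p q} → T (gcdsAdj p q) →
           (does (p ∈? vertices G) ∧ not (deleted p)) ≡ true
    kept {p} {q} t =
      combine (listed p) (dec-true (p ∈? vertices G) (gcdsAdj-closed p q t))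
        (gcdsAdj-end p q t) (nonisolated {p} {q} t)
      where
      combine : ∀ l {v x i o} → v ≡ true → x ≡ false → i ≡ false →
                v ∧ not (x ∨ (l ∧ i ∧ not o)) ≡ true
      combine false refl refl refl = refl
      combine true  refl refl refl = refl

  -- Every deleted vertex is isolated in gcds G e, so the edge set is unchanged.
  gcds₂ : Graph n
  gcds₂ = record
    { vertices   = remaining
    ; adj        = gcdsAdj
    ; adj-sym    = gcdsAdj-sym
    ; adj-irrefl = gcdsAdj-irrefl
    ; adj-closed = λ {p} {q} t → lookup⇒[]= p remaining
        (trans (lookup∘tabulate _ p) (kept {p} {q} t))
    }

data Player : Set where
  ONE TWO : Player

opponent : Player → Player
opponent ONE = TWO
opponent TWO = ONE

Ended : Graph n → Set
Ended C = ¬ Edge C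

-- Play G C: the partial plays (move sequences) leading from G to C.
infixl 5 _▷_
data Play (G : Graph n) : Graph n → Set where
  start : Play G G
  _▷_   : ∀ {C} → Play G C → (e : Edge C) → Play G (gcds₂ C e)

toMove : {G C : Graph n} → Play G C → Player
toMove start   = ONE
toMove (h ▷ _) = opponent (toMove h)

-- The hypotheses are irrelevant so that the chosen move depends on the partial
-- play alone, not on how these facts about it are proved.
Strategy : Player → Graph n → Set
Strategy P G =
  ∀ {C} (h : Play G C) → .(toMove h ≡ P) → .(¬ Ended C) → Edge C

Follows : {P : Player} {G C : Graph n} → Strategy P G → Play G C → Set
Follows σ start = ⊤
Follows {P = P} σ (h ▷ e) =
  Follows σ h ×
  ((turn : toMove h ≡ P) → e ≡ σ h turn (λ ended → ended e))

WonBy : Player → Subset n → Graph n → Set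
WonBy ONE A C = Nonempty (vertices C) × vertices C ⊆ A
WonBy TWO A C = ¬ WonBy ONE A C

-- Only finite plays need to be considered: each move deletes a and b, so no
-- play is infinite.
Winning : {P : Player} {G : Graph n} → Subset n → Strategy P G → Set
Winning {P = P} {G = G} A σ =
  ∀ {C} (h : Play G C) → Ended C → Follows σ h → WonBy P A C

HasWinningStrategy : Player → Graph n → Subset n → Set
HasWinningStrategy P G A = Σ (Strategy P G) (Winning A)

Determined : Graph n → Subset n → Set
Determined G A = HasWinningStrategy ONE G A ⊎ HasWinningStrategy TWO G A

module Submission where

-- The vertex set shrinks strictly at every move, so backward induction decides
-- which player wins from each position.  A player who wins from the initial position
-- stays among positions won by that player, choosing each move from the current
-- graph alone.

open import Defs
open import Data.Bool.Base using (Bool; true)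
open import Data.Bool.Properties using (T?; T-irrelevant; ∧-zeroʳ)
open import Data.Fin.Base using (Fin)
open import Data.Fin.Properties using (_≟_; _<?_; any?; <-irrelevant)
open import Data.Fin.Subset using (Subset; _⊆_; _⊂_; _∈_; _∉_)
open import Data.Fin.Subset.Induction using (⊂-wellFounded)
open import Data.Fin.Subset.Properties using (_∈?_; nonempty?; _⊆?_)
open import Data.Nat.Base using (ℕ)
open import Data.Product.Base using (Σ; ∃; _,_; proj₁; proj₂)
open import Data.Sum.Base using (_⊎_; inj₁; inj₂; [_,_]′)
open import Data.Vec.Base using (tabulate)
open import Data.Vec.Properties using ([]=⇒lookup; lookup∘tabulate)
open import Function.Base using (_∘_)
open import Induction.WellFounded using (Acc; acc)
open import Relation.Binary.PropositionalEquality
  using (_≡_; refl; sym; trans; cong; subst)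
open import Relation.Nullary
  using (¬_; Dec; does; yes; no; Irrelevant; ¬?; _×-dec_; contradiction;
         contradiction-irr)
open import Relation.Nullary.Decidable using (map′; decidable-stable)
open import Relation.Unary using (Decidable)

private
  variable
    n : ℕ
    G C : Graph n

∈-tabulate⁻ : {f : Fin n → Bool} {v : Fin n} → v ∈ tabulate f → f v ≡ true
∈-tabulate⁻ {f = f} {v} v∈ = trans (sym (lookup∘tabulate f v)) ([]=⇒lookup v∈)

remaining-⊆ : (G : Graph n) (e : Edge G) → remaining G e ⊆ vertices G
remaining-⊆ G e {v} v∈ with v ∈? vertices G | ∈-tabulate⁻ v∈
... | yes v∈G | _ = v∈G
... | no _    | ()

a∉remaining : (G : Graph n) (e : Edge G) → Edge.a e ∉ remaining G e
a∉remaining G (edge a b _ _) a∈ with a ≟ a | ∈-tabulate⁻ a∈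
... | no a≢a | _  = a≢a refl
-- With `a ≟ a` decided, `deleted` computes to `true` at `a`, so the tabulated entry is a
-- conjunction with `false`.
... | yes _  | eq rewrite ∧-zeroʳ (does (a ∈? vertices G)) with () ← eq

-- Strictness is witnessed by the endpoint `a`: it has a neighbour, so it is a vertex, and every
-- move deletes it.
gcds₂-⊂ : (G : Graph n) (e : Edge G) → vertices (gcds₂ G e) ⊂ vertices G
gcds₂-⊂ G e@(edge a _ _ adjacent) =
  (λ {v} → remaining-⊆ G e {v}) , a , adj-closed G adjacent , a∉remaining G e

-- Since all proofs of `P` are equal, testing `Q` at a single one settles the sum. This fits the two
-- proof fields of an edge.
Σ-dec : {P : Set} {Q : P → Set} →
        Irrelevant P → Dec P → Decidable Q → Dec (Σ P Q)
Σ-dec irr (no ¬p) Q? = no (¬p ∘ proj₁)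
Σ-dec {Q = Q} irr (yes p) Q? =
  map′ (p ,_) (λ (p′ , q) → subst Q (irr p′ p) q) (Q? p)

anyEdge? : {Q : Edge C → Set} → Decidable Q → Dec (∃ Q)
anyEdge? {C = C} Q? = map′
  (λ (a , b , a<b , adjacent , q) → edge a b a<b adjacent , q)
  (λ (edge a b a<b adjacent , q) → a , b , a<b , adjacent , q)
  (any? λ a → any? λ b →
    Σ-dec <-irrelevant (a <? b) λ a<b →
    Σ-dec T-irrelevant (T? (adj C a b)) λ adjacent →
    Q? (edge a b a<b adjacent))

edge? : (C : Graph n) → Dec (Edge C)
edge? C = map′ proj₁ (λ e → e , e) (anyEdge? {Q = λ _ → Edge C} yes)

module _ (A : Subset n) where

  -- The player argument is the one to move. `every` asks for an edge because otherwise an ended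
  -- position would satisfy it vacuously, whatever its vertex set.
  data OneWins : Player → Graph n → Set where
    over  : ∀ {m} → Ended C → WonBy ONE A C → OneWins m C
    some  : (e : Edge C) → OneWins TWO (gcds₂ C e) → OneWins ONE C
    every : Edge C → (∀ e → OneWins ONE (gcds₂ C e)) → OneWins TWO C

  oneWonBy : ∀ {m} → OneWins m C → Ended C → WonBy ONE A C
  oneWonBy (over _ won) _     = won
  oneWonBy (some e _)   ended = contradiction e ended
  oneWonBy (every e _)  ended = contradiction e ended

  oneWins? : ∀ m (C : Graph n) → Acc _⊂_ (vertices C) → Dec (OneWins m C)
  oneWins? m C (acc rec) with edge? C
  oneWins? m C (acc rec) | no ended =
    map′ (over ended) (λ w → oneWonBy w ended)
      (nonempty? (vertices C) ×-dec (vertices C ⊆? A))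
  oneWins? ONE C (acc rec) | yes e₀ =
    map′ (λ (e , w) → some e w)
      (λ { (over ended _) → contradiction e₀ ended ; (some e w) → e , w })
      (anyEdge? λ e → oneWins? TWO (gcds₂ C e) (rec (gcds₂-⊂ C e)))
  -- A universal statement over edges is decided by searching for a counterexample; decidability of
  -- the next positions removes the double negation.
  oneWins? TWO C (acc rec) | yes e₀ = map′
    (λ none → every e₀ λ e → decidable-stable (next? e) λ ¬w → none (e , ¬w))
    (λ { (over ended _) → contradiction e₀ ended
       ; (every _ w) (e , ¬w) → ¬w (w e) })
    (¬? (anyEdge? (¬? ∘ next?)))
    where
    next? : ∀ e → Dec (OneWins ONE (gcds₂ C e))
    next? e = oneWins? ONE (gcds₂ C e) (rec (gcds₂-⊂ C e))

  -- The first player is the one who wins, the second the one to move. With TWO's wins taken as the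
  -- complement of ONE's, determinacy reduces to deciding `OneWins`.
  Wins : Player → Player → Graph n → Set
  Wins ONE m C = OneWins m C
  Wins TWO m C = ¬ OneWins m C

  wins? : ∀ P m C → Dec (Wins P m C)
  wins? ONE m C = oneWins? m C (⊂-wellFounded _)
  wins? TWO m C = ¬? (wins? ONE m C)

  wins-ended : ∀ P {m} → Wins P m C → Ended C → WonBy P A C
  wins-ended ONE w       = oneWonBy w
  wins-ended TWO w ended = w ∘ over ended

  -- For TWO, a move into a position won by ONE would already be a winning move for ONE, by `some`.
  wins-every : ∀ P → Wins P (opponent P) C → (e : Edge C) → Wins P P (gcds₂ C e)
  wins-every ONE (over ended _) e = contradiction e ended
  wins-every ONE (every _ w)    e = w e
  wins-every TWO w              e = w ∘ some e

  -- For TWO, decidability allows an argument by contradiction: if every move led to a win for ONE,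
  -- then `every` would make the current position one too.
  wins-some : ∀ P → Wins P P C → Edge C →
              ∃ λ (e : Edge C) → Wins P (opponent P) (gcds₂ C e)
  wins-some ONE (over ended _) e₀ = contradiction e₀ ended
  wins-some ONE (some e w)     _  = e , w
  wins-some {C = C} TWO w e₀ =
    decidable-stable (anyEdge? λ e → wins? TWO ONE (gcds₂ C e)) λ none →
      w (every e₀ λ e →
        decidable-stable (wins? ONE ONE (gcds₂ C e)) λ ¬w → none (e , ¬w))

  winningMove? : ∀ P C → Dec (∃ λ (e : Edge C) → Wins P (opponent P) (gcds₂ C e))
  winningMove? P C = anyEdge? λ e → wins? P (opponent P) (gcds₂ C e)

  strategy : ∀ P G → Strategy P G
  strategy P G {C} _ _ ¬ended with winningMove? P C | edge? C
  ... | yes (e , _) | _        = e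
  -- Without a winning move any edge serves as default. It comes from `edge?`, since the irrelevant
  -- `¬ended` supplies none.
  ... | no _        | yes e    = e
  ... | no _        | no ended = contradiction-irr ¬ended (contradiction ended)

  strategy-wins : ∀ P {h : Play G C} .(turn : toMove h ≡ P) .(¬ended : ¬ Ended C) →
                  Wins P P C →
                  Wins P (opponent P) (gcds₂ C (strategy P G h turn ¬ended))
  -- Splitting on the same two decisions as `strategy` makes the chosen move compute.
  strategy-wins {C = C} P turn ¬ended w with winningMove? P C | edge? C
  ... | yes (_ , w′) | _        = w′
  ... | no none      | yes e    = contradiction (wins-some P w e) none
  ... | no _         | no ended = contradiction-irr ¬ended (contradiction ended)

  onTurn : ∀ P m → m ≡ P ⊎ m ≡ opponent P
  onTurn ONE ONE = inj₁ refl
  onTurn ONE TWO = inj₂ refl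
  onTurn TWO ONE = inj₂ refl
  onTurn TWO TWO = inj₁ refl

  opponent-involutive : ∀ P → opponent (opponent P) ≡ P
  opponent-involutive ONE = refl
  opponent-involutive TWO = refl

  wins-own : ∀ P (h : Play G C) (e : Edge C) (turn : toMove h ≡ P) →
             e ≡ strategy P G h turn (λ ended → ended e) →
             Wins P (toMove h) C → Wins P (toMove (h ▷ e)) (gcds₂ C e)
  wins-own {C = C} P h e turn played w =
    subst (λ m → Wins P (opponent m) (gcds₂ C e)) (sym turn)
      (subst (λ e′ → Wins P (opponent P) (gcds₂ C e′)) (sym played)
        (strategy-wins P {h} turn (λ ended → ended e)
          (subst (λ m → Wins P m C) turn w)))

  wins-other : ∀ P (h : Play G C) (e : Edge C) → toMove h ≡ opponent P →
               Wins P (toMove h) C → Wins P (toMove (h ▷ e)) (gcds₂ C e)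
  wins-other {C = C} P h e turn w =
    subst (λ m → Wins P m (gcds₂ C e))
      (sym (trans (cong opponent turn) (opponent-involutive P)))
      (wins-every P (subst (λ m → Wins P m C) turn w) e)

  -- Induction on the play: being won by `P` survives the prescribed moves of `P` and all moves of
  -- the opponent.
  follows-wins : ∀ P → Wins P ONE G → (h : Play G C) →
                 Follows (strategy P G) h → Wins P (toMove h) C
  follows-wins P w start _ = w
  follows-wins P w (h ▷ e) (follows , played) =
    [ (λ turn → wins-own P h e turn (played turn) wₕ)
    , (λ turn → wins-other P h e turn wₕ)
    ]′ (onTurn P (toMove h))
    where
    wₕ = follows-wins P w h follows

  strategy-winning : ∀ P → Wins P ONE G → HasWinningStrategy P G A
  strategy-winning {G = G} P w = strategy P G , λ h ended follows →
    wins-ended P (follows-wins P w h follows) ended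

theorem3 : (n : ℕ) (G : Graph n) (A : Subset n) →
    A ⊆ vertices G → Determined G A
theorem3 n G A _ with wins? A ONE ONE G
... | yes w = inj₁ (strategy-winning A ONE w)
-- By definition of `Wins`, `¬w` says that TWO wins from `G` with ONE to move.
... | no ¬w = inj₂ (strategy-winning A TWO ¬w)
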